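{- Let $a, b \ge 2$ be even integers, at least one of which is not divisible by four. Then $R_\mathrm{cyc}(M_a^\mathrm{nest}, M_b^\mathrm{nest}) = a + b - 2$.
   Context: All graphs are finite, simple and undirected, and a graph of order $n$ has vertex set $\{0,1,\ldots,n-1\}$; $K_n$ is the complete graph on $\{0,\ldots,n-1\}$. A $2$-edge-coloring of $K_n$ assigns each edge a color in $\{1,2\}$. For a graph $H$ and such a coloring, an embedding of $H$ in color $j$ is an injective map $\varphi\colon V(H)\to V(K_n)$ such that for every edge $uv$ of $H$ the edge $\{\varphi(u),\varphi(v)\}$ has color $j$; it is increasing up to a cyclic permutation if there exists $t\in V(H)$ such that $(\varphi(t),\ldots,\varphi(|H|-1),\varphi(0),\ldots,\varphi(t-1))$ is increasing. The cyclic Ramsey number $R_\mathrm{cyc}(H_1,H_2)$ is the smallest $n$ such that every $2$-edge-coloring of $K_n$ admits an embedding of $H_1$ in color $1$ or of $H_2$ in color $2$ that is increasing up to a cyclic permutation. For even $n\ge2$, the nested matching $M_n^\mathrm{nest}$ is the graph of order $n$ whose edges are $\{v,n-1-v\}$ for $0\le v\le n/2-1$. -}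

module Defs where

open import Data.Fin using (Fin; toℕ; _<_)
open import Data.Fin.Properties using (toℕ<n)
open import Data.List using (List; map; _++_; take; drop; allFin)
open import Data.List.Relation.Unary.AllPairs using (AllPairs)
open import Data.Nat as ℕ using (ℕ; suc; _+_; _*_; _∸_; _≤_; _/_)
open import Data.Nat.DivMod using (m/n*n≤m)
open import Data.Nat.Properties as ℕ using ()
open import Data.Product using (_×_; _,_; ∃-syntax)
open import Data.Sum using (_⊎_; [_,_]′; swap)
open import Function.Definitions using (Injective)
open import Relation.Binary.Definitions using (Decidable)
open import Relation.Binary.PropositionalEquality using (_≡_; refl; cong)
open import Relation.Nullary using (¬_)
open import Relation.Nullary.Decidable using (_×-dec_; _⊎-dec_)

record Graph (n : ℕ) : Set₁ where
  field
    Adj     : Fin n → Fin n → Set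
    adj?    : Decidable Adj
    symm    : ∀ {u v} → Adj u v → Adj v u
    irrefl  : ∀ {v} → ¬ Adj v v

data Color : Set where
  color₁ color₂ : Color

-- An edge coloring of Kₙ. The values on the diagonal carry no meaning: they are
-- never inspected below, since graphs are loopless and embeddings injective.
record Coloring (n : ℕ) : Set where
  field
    color : Fin n → Fin n → Color
    symm  : ∀ u v → color u v ≡ color v u

record IsEmbedding {h n : ℕ} (H : Graph h) (c : Coloring n) (j : Color)
                   (φ : Fin h → Fin n) : Set where
  field
    injective : Injective _≡_ _≡_ φ
    colored   : ∀ {u v} → Graph.Adj H u v → Coloring.color c (φ u) (φ v) ≡ j

-- The sequence t, …, h-1, 0, …, t-1.
rotation : ∀ {h} → Fin h → List (Fin h)
rotation {h} t = drop (toℕ t) (allFin h) ++ take (toℕ t) (allFin h)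

Increasing : ∀ {n} → List (Fin n) → Set
Increasing = AllPairs _<_

CyclicallyIncreasing : ∀ {h n} → (Fin h → Fin n) → Set
CyclicallyIncreasing φ = ∃[ t ] Increasing (map φ (rotation t))

HasCyclicEmbedding : ∀ {h n} → Graph h → Coloring n → Color → Set
HasCyclicEmbedding H c j = ∃[ φ ] (IsEmbedding H c j φ × CyclicallyIncreasing φ)

CyclicArrows : ∀ {h₁ h₂} → ℕ → Graph h₁ → Graph h₂ → Set
CyclicArrows n H₁ H₂ = (c : Coloring n) →
  HasCyclicEmbedding H₁ c color₁ ⊎ HasCyclicEmbedding H₂ c color₂

-- The graph of the partial function R_cyc: IsRcyc H₁ H₂ n means R_cyc(H₁, H₂) = n.
IsRcyc : ∀ {h₁ h₂} → Graph h₁ → Graph h₂ → ℕ → Set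
IsRcyc H₁ H₂ n = CyclicArrows n H₁ H₂ × (∀ m → CyclicArrows m H₁ H₂ → n ≤ m)

-- NestedEdge n u w: the pair (u , w) is (v , n-1-v) with 0 ≤ v ≤ n/2-1.
NestedEdge : ∀ n → Fin n → Fin n → Set
NestedEdge n u w = toℕ u ℕ.< n / 2 × toℕ w ≡ n ∸ 1 ∸ toℕ u

private
  nestedEdge-irrefl : ∀ {n} {v : Fin n} → ¬ NestedEdge n v v
  nestedEdge-irrefl {suc n} {v} (v<n/2 , v≡n-v) = ℕ.<-irrefl refl (begin-strict
    suc n                <⟨ ℕ.n<1+n (suc n) ⟩
    2 + n                ≡⟨ cong (2 +_) (ℕ.m+[n∸m]≡n (ℕ.≤-pred (toℕ<n v))) ⟨
    2 + (k + (n ∸ k))    ≡⟨ cong (λ x → 2 + (k + x)) v≡n-v ⟨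
    2 + (k + k)          ≡⟨ cong (λ x → 2 + (k + x)) (ℕ.+-identityʳ k) ⟨
    2 + 2 * k            ≡⟨ ℕ.*-suc 2 k ⟨
    2 * suc k            ≡⟨ ℕ.*-comm 2 (suc k) ⟩
    suc k * 2            ≤⟨ ℕ.*-monoˡ-≤ 2 v<n/2 ⟩
    suc n / 2 * 2        ≤⟨ m/n*n≤m (suc n) 2 ⟩
    suc n                ∎)
    where
    open ℕ.≤-Reasoning
    k = toℕ v

nestedMatching : ∀ n → Graph n
nestedMatching n = record
  { Adj    = λ u w → NestedEdge n u w ⊎ NestedEdge n w u
  ; adj?   = λ u w → nestedEdge? u w ⊎-dec nestedEdge? w u
  ; symm   = swap
  ; irrefl = [ nestedEdge-irrefl , nestedEdge-irrefl ]′
  }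
  where
  nestedEdge? : Decidable (NestedEdge n)
  nestedEdge? u w = (toℕ u ℕ.<? n / 2) ×-dec (toℕ w ℕ.≟ n ∸ 1 ∸ toℕ u)

{-# OPTIONS --safe #-}
module Submission where

-- Write a = 2k, b = 2l and view the vertices of Kₙ as points on a circle. A cyclic copy of a
-- nested matching is then a stack of parallel chords.
-- Upper bound: for n = 2(k + l - 1) the k + l - 1 chords {i , n-1-i} form one stack, and k of them
-- have color 1 or l of them have color 2.
-- Lower bound, say with l odd: for N = 2(k + l) - 3 color a chord 1 if both its arcs have length
-- at least l, and 2 otherwise. In a stack of k chords of color 1 the two extreme chords cut off
-- arcs of length at least l, so N ≥ 2(k - 1) + 2l. In any stack of l chords the middle one has
-- l - 1 endpoints on either side, hence color 1.

open import Defs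
open import Data.Empty using (⊥-elim)
open import Data.Fin as Fin using (Fin; zero; suc; toℕ; fromℕ<; inject≤; opposite)
open import Data.Fin.Properties using (toℕ<n; toℕ-fromℕ<; toℕ-injective; toℕ-inject≤; opposite-prop; opposite-involutive) renaming (<-cmp to <-cmpᶠ; <-irrefl to <-irreflᶠ)
open import Data.List using (List; []; _∷_; _++_; take; drop; tabulate; allFin)
open import Data.List.Membership.Propositional using (_∈_)
open import Data.List.Membership.Propositional.Properties using (∈-tabulate⁺)
open import Data.List.Properties using (++-identityʳ)
open import Data.List.Relation.Unary.All as All using ()
open import Data.List.Relation.Unary.All.Properties as All using ()
open import Data.List.Relation.Unary.AllPairs as AllPairs using (AllPairs; []; _∷_)
open import Data.List.Relation.Unary.AllPairs.Properties as AllPairs using ()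
open import Data.List.Relation.Unary.Any using (here; there)
open import Data.Nat using (ℕ; zero; suc; _+_; _*_; _∸_; ∣_-_∣; _≤_; _<_; _≤?_; _<?_; z≤n; s≤s; z<s)
open import Data.Nat.Divisibility using (_∣_; divides)
open import Data.Nat.DivMod using (m*n/n≡m)
open import Data.Nat.Properties
open import Data.Nat.Tactic.RingSolver using (solve-∀)
open import Data.Product using (_×_; _,_; ∃-syntax; proj₁; proj₂)
open import Data.Sum using (_⊎_; inj₁; inj₂; map₁; map₂; [_,_]′)
open import Function using (_∘_; _on_; id)
open import Relation.Binary.Definitions using (tri<; tri≈; tri>)
open import Relation.Binary.PropositionalEquality using (_≡_; _≢_; refl; sym; trans; cong; cong₂; subst; subst₂; module ≡-Reasoning)
open import Relation.Nullary using (¬_; Dec; yes; no; contradiction)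
open import Relation.Nullary.Decidable using (_×-dec_)

private
  variable
    A : Set
    h k l m n q N : ℕ

-- Monotone maps on Fin

Monotone : (Fin h → Fin n) → Set
Monotone φ = ∀ {u v} → u Fin.< v → φ u Fin.< φ v

monotone⇒injective : {φ : Fin h → Fin n} → Monotone φ → ∀ {u v} → φ u ≡ φ v → u ≡ v
monotone⇒injective φ-mono {u} {v} φu≡φv with <-cmpᶠ u v
... | tri< u<v _ _ = contradiction (φ-mono u<v) (<-irreflᶠ φu≡φv)
... | tri≈ _ u≡v _ = u≡v
... | tri> _ _ v<u = contradiction (φ-mono v<u) (<-irreflᶠ (sym φu≡φv))

-- The rotation starts at vertex 0. A cyclic order needs such a starting vertex, hence the order
-- `suc h`.
monotone⇒cyclicallyIncreasing : {φ : Fin (suc h) → Fin n} → Monotone φ → CyclicallyIncreasing φ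
monotone⇒cyclicallyIncreasing {h} {φ = φ} φ-mono = zero , AllPairs.map⁺
  (subst (AllPairs (Fin._<_ on φ)) (sym (++-identityʳ (allFin (suc h)))) (AllPairs.tabulate⁺-< φ-mono))

opposite-< : {u v : Fin n} → u Fin.< v → opposite v Fin.< opposite u
opposite-< {u = u} {v} u<v = subst₂ _<_ (sym (opposite-prop v)) (sym (opposite-prop u))
  (∸-monoʳ-< (s≤s u<v) (toℕ<n v))

-- The upper bound

-- A set of k positions of color j is encoded by its increasing enumeration, so that the chosen
-- chords keep their nesting order.
record MonochromaticIndices (P : Fin q → Color) (j : Color) (k : ℕ) : Set where
  constructor indices
  field
    index    : Fin k → Fin q
    monotone : Monotone index
    colored  : ∀ i → P (index i) ≡ j

private
  none : ∀ {P : Fin q → Color} {j} → MonochromaticIndices P j 0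
  none = indices (λ ()) (λ {}) (λ ())

  skip : ∀ {P : Fin (suc q) → Color} {j} → MonochromaticIndices (P ∘ suc) j k → MonochromaticIndices P j k
  skip (indices g g-mono g-col) = indices (suc ∘ g) (s≤s ∘ g-mono) g-col

  extend : ∀ {P : Fin (suc q) → Color} {j} → P zero ≡ j → MonochromaticIndices (P ∘ suc) j k →
           MonochromaticIndices P j (suc k)
  extend {q} {k} {P} {j} P0≡j (indices g g-mono g-col) = indices g′ g′-mono g′-col
    where
    g′ : Fin (suc k) → Fin (suc q)
    g′ zero    = zero
    g′ (suc i) = suc (g i)
    g′-mono : Monotone g′
    g′-mono {zero}  {suc v} _         = z<s
    g′-mono {suc u} {suc v} (s≤s u<v) = s≤s (g-mono u<v)
    g′-col : ∀ i → P (g′ i) ≡ j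
    g′-col zero    = P0≡j
    g′-col (suc i) = g-col i

-- Induction on q: the color of position 0 decides whether k or l drops by one. The bound says k + l
-- - 1 ≤ q without truncated subtraction.
pigeonhole : ∀ q k l → k + l ≤ suc q → (P : Fin q → Color) →
             MonochromaticIndices P color₁ k ⊎ MonochromaticIndices P color₂ l
pigeonhole q       zero    l       _ P = inj₁ none
pigeonhole q       (suc k) zero    _ P = inj₂ none
pigeonhole zero    (suc k) (suc l) (s≤s k+1+l≤0) P = contradiction (≤-trans (m≤n+m (suc l) k) k+1+l≤0) λ ()
pigeonhole (suc q) (suc k) (suc l) (s≤s k+1+l≤1+q) P with P zero in eq
... | color₁ = map₁ (extend eq) (map₂ skip (pigeonhole q k (suc l) k+1+l≤1+q (P ∘ suc)))
... | color₂ = map₁ skip (map₂ (extend eq)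
  (pigeonhole q (suc k) l (subst (_≤ suc q) (+-suc k l) k+1+l≤1+q) (P ∘ suc)))

-- Stacks built from selected parallel chords

module Nest {k q} (g : Fin k → Fin q) where

  private
    2*-split : ∀ n → n * 2 ≡ n + n
    2*-split = solve-∀

  low : Fin k → Fin (q * 2)
  low i = inject≤ (g i) (m≤m*n q 2)

  toℕ-low : ∀ i → toℕ (low i) ≡ toℕ (g i)
  toℕ-low i = toℕ-inject≤ (g i) _

  opposite<k : (v : Fin (k * 2)) → ¬ toℕ v < k → toℕ (opposite v) < k
  opposite<k v v≮k = +-cancelʳ-≤ k _ _ (begin
    suc (toℕ (opposite v)) + k          ≤⟨ +-monoʳ-≤ _ (≮⇒≥ v≮k) ⟩
    suc (toℕ (opposite v)) + toℕ v      ≡⟨ +-suc _ _ ⟨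
    toℕ (opposite v) + suc (toℕ v)      ≡⟨ cong (_+ suc (toℕ v)) (opposite-prop v) ⟩
    k * 2 ∸ suc (toℕ v) + suc (toℕ v)   ≡⟨ m∸n+n≡m (toℕ<n v) ⟩
    k * 2                               ≡⟨ 2*-split k ⟩
    k + k                               ∎)
    where open ≤-Reasoning

  -- The lower half of the vertices enumerates the lower endpoints of the chosen chords. An upper
  -- vertex goes to the mirror image of its partner's image, so every edge becomes a chosen chord.
  nest : Fin (k * 2) → Fin (q * 2)
  nest v with toℕ v <? k
  ... | yes v<k = low (fromℕ< v<k)
  ... | no  v≮k = opposite (low (fromℕ< (opposite<k v v≮k)))

  low<opposite-low : ∀ i j → low i Fin.< opposite (low j)
  low<opposite-low i j = begin-strict
    toℕ (low i)              ≡⟨ toℕ-low i ⟩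
    toℕ (g i)                <⟨ toℕ<n (g i) ⟩
    q                        ≡⟨ m+n∸n≡m q q ⟨
    q + q ∸ q                ≡⟨ cong (_∸ q) (2*-split q) ⟨
    q * 2 ∸ q                ≤⟨ ∸-monoʳ-≤ (q * 2) (toℕ<n (g j)) ⟩
    q * 2 ∸ suc (toℕ (g j))  ≡⟨ cong (λ x → q * 2 ∸ suc x) (toℕ-low j) ⟨
    q * 2 ∸ suc (toℕ (low j)) ≡⟨ opposite-prop (low j) ⟨
    toℕ (opposite (low j))   ∎
    where open ≤-Reasoning

  module _ (g-mono : Monotone g) where

    low-fromℕ<-mono : .(p : m < k) .(r : n < k) → m < n → low (fromℕ< p) Fin.< low (fromℕ< r)
    low-fromℕ<-mono p r m<n = subst₂ _<_ (sym (toℕ-low _)) (sym (toℕ-low _))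
      (g-mono (subst₂ _<_ (sym (toℕ-fromℕ< p)) (sym (toℕ-fromℕ< r)) m<n))

    nest-mono : Monotone nest
    nest-mono {u} {v} u<v with toℕ u <? k | toℕ v <? k
    ... | yes u<k | yes v<k = low-fromℕ<-mono u<k v<k u<v
    ... | yes u<k | no  v≮k = low<opposite-low _ _
    ... | no  u≮k | yes v<k = contradiction (<-trans u<v v<k) u≮k
    -- The order is reversed twice, once by passing to the partners and once by reflecting their
    -- images.
    ... | no  u≮k | no  v≮k = opposite-< (low-fromℕ<-mono _ _ (opposite-< u<v))

  nest-edge : ∀ {u w} → NestedEdge (k * 2) u w → ∃[ i ] nest u ≡ low i × nest w ≡ opposite (low i)
  nest-edge {u} {w} (u<[2k]/2 , w≡) with toℕ u <? k | toℕ w <? k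
  ... | no u≮k | _ = contradiction (subst (toℕ u <_) (m*n/n≡m k 2) u<[2k]/2) u≮k
  -- Since w = 2k - 1 - u with u < k, the partner w is at least k.
  ... | yes u<k | yes w<k = ⊥-elim (<-irrefl refl (begin-strict
    k                     ≡⟨ m+n∸n≡m k k ⟨
    k + k ∸ k             ≡⟨ cong (_∸ k) (2*-split k) ⟨
    k * 2 ∸ k             ≤⟨ ∸-monoʳ-≤ (k * 2) u<k ⟩
    k * 2 ∸ suc (toℕ u)   ≡⟨ ∸-+-assoc (k * 2) 1 (toℕ u) ⟨
    k * 2 ∸ 1 ∸ toℕ u     ≡⟨ w≡ ⟨
    toℕ w                 <⟨ w<k ⟩
    k                     ∎))
    where open ≤-Reasoning
  ... | yes u<k | no w≮k = fromℕ< u<k , refl ,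
    cong (opposite ∘ low) (toℕ-injective (trans (toℕ-fromℕ< _) (trans (cong toℕ opp-w≡u) (sym (toℕ-fromℕ< u<k)))))
    where
    opp-w≡u : opposite w ≡ u
    opp-w≡u = trans
      (cong opposite (toℕ-injective (trans w≡ (trans (∸-+-assoc (k * 2) 1 (toℕ u)) (sym (opposite-prop u))))))
      (opposite-involutive u)

module _ (c : Coloring (q * 2)) where

  open Coloring c

  chordColor : Fin q → Color
  chordColor i = color i′ (opposite i′)
    where i′ = inject≤ i (m≤m*n q 2)

  nestedEmbedding : ∀ {j} → MonochromaticIndices chordColor j (suc k) →
                    HasCyclicEmbedding (nestedMatching (suc k * 2)) c j
  nestedEmbedding {k} {j} (indices g g-mono g-col) = nest , record
    { injective = monotone⇒injective (nest-mono g-mono)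
    ; colored   = λ { (inj₁ e) → colored e ; (inj₂ e) → trans (symm _ _) (colored e) }
    } , monotone⇒cyclicallyIncreasing (nest-mono g-mono)
    where
    open Nest g
    colored : ∀ {u w} → NestedEdge (suc k * 2) u w → color (nest u) (nest w) ≡ j
    colored e with i , nu≡ , nw≡ ← nest-edge e = trans (cong₂ color nu≡ nw≡) (g-col i)

-- Here a = 2(k + 1) and b = 2(l + 1), so the k + l + 1 chords are one fewer than the two stack
-- sizes together, exactly what the pigeonhole needs.
arrows : ∀ k l → CyclicArrows (suc (k + l) * 2) (nestedMatching (suc k * 2)) (nestedMatching (suc l * 2))
arrows k l c = map₁ (nestedEmbedding c) (map₂ (nestedEmbedding c)
  (pigeonhole (suc (k + l)) (suc k) (suc l) (≤-reflexive (cong suc (+-suc k l))) (chordColor c)))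

-- Cyclically increasing maps

private
  variable
    R : A → A → Set

AllPairs-++⁻ : ∀ (xs : List A) {ys} → AllPairs R (xs ++ ys) →
               AllPairs R xs × AllPairs R ys × (∀ {x y} → x ∈ xs → y ∈ ys → R x y)
AllPairs-++⁻ []       Rys        = [] , Rys , λ ()
AllPairs-++⁻ (x ∷ xs) (px ∷ pxs) with Rxs , Rys , Rxy ← AllPairs-++⁻ xs pxs =
  All.++⁻ˡ xs px ∷ Rxs , Rys ,
  λ { (here refl) y∈ys → All.lookup (All.++⁻ʳ xs px) y∈ys ; (there x∈xs) → Rxy x∈xs }

∈-drop-tabulate : (f : Fin n → A) (t : ℕ) {i : Fin n} → t ≤ toℕ i → f i ∈ drop t (tabulate f)
∈-drop-tabulate f zero {i} _ = ∈-tabulate⁺ i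
∈-drop-tabulate f (suc t) {suc i} (s≤s t≤i) = ∈-drop-tabulate (f ∘ suc) t t≤i

∈-take-tabulate : (f : Fin n → A) (t : ℕ) {i : Fin n} → toℕ i < t → f i ∈ take t (tabulate f)
∈-take-tabulate f (suc t) {zero}  _         = here refl
∈-take-tabulate f (suc t) {suc i} (s≤s i<t) = there (∈-take-tabulate (f ∘ suc) t i<t)

AllPairs-drop-tabulate⁻ : (f : Fin n → A) (t : ℕ) → AllPairs R (drop t (tabulate f)) →
                          ∀ {i j} → t ≤ toℕ i → i Fin.< j → R (f i) (f j)
AllPairs-drop-tabulate⁻ f zero (p ∷ ps) {zero} {suc j} _ _ = All.lookup p (∈-tabulate⁺ j)
AllPairs-drop-tabulate⁻ f zero (p ∷ ps) {suc i} {suc j} _ (s≤s i<j) =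
  AllPairs-drop-tabulate⁻ (f ∘ suc) zero ps z≤n i<j
AllPairs-drop-tabulate⁻ f (suc t) ps {suc i} {suc j} (s≤s t≤i) (s≤s i<j) =
  AllPairs-drop-tabulate⁻ (f ∘ suc) t ps t≤i i<j

AllPairs-take-tabulate⁻ : (f : Fin n → A) (t : ℕ) → AllPairs R (take t (tabulate f)) →
                          ∀ {i j} → toℕ j < t → i Fin.< j → R (f i) (f j)
AllPairs-take-tabulate⁻ f (suc t) (p ∷ ps) {zero} {suc j} (s≤s j<t) _ =
  All.lookup p (∈-take-tabulate (f ∘ suc) t j<t)
AllPairs-take-tabulate⁻ f (suc t) (p ∷ ps) {suc i} {suc j} (s≤s j<t) (s≤s i<j) =
  AllPairs-take-tabulate⁻ (f ∘ suc) t ps j<t i<j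

-- Far l N d: two points of ℤ/N at difference d have both arcs between them of length at least l.
Far : ℕ → ℕ → ℕ → Set
Far l N d = l ≤ d × d + l ≤ N

far? : ∀ l N d → Dec (Far l N d)
far? l N d = (l ≤? d) ×-dec (d + l ≤? N)

-- This is `Far` for the difference y - x, written without subtraction: the arcs run from x to y and
-- from y to x + N.
FarLifts : ℕ → ℕ → ℕ → ℕ → Set
FarLifts l N x y = x + l ≤ y × y + l ≤ x + N

-- Unrolling the circle: lift u is congruent to φ u modulo N, and the lifts are increasing
-- within a window of length N.
module Lift {h m} (N : ℕ) (m≤N : m ≤ N) (φ : Fin h → Fin m) (φ-cyc : CyclicallyIncreasing φ) where

  private
    t : Fin h
    t = proj₁ φ-cyc

    φℕ<N : ∀ u → toℕ (φ u) < N
    φℕ<N u = <-≤-trans (toℕ<n (φ u)) m≤N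

    pieces = AllPairs-++⁻ (drop (toℕ t) (allFin h)) (AllPairs.map⁻ {xs = rotation t} (proj₂ φ-cyc))

    mono-≥t : ∀ {u v} → toℕ t ≤ toℕ u → u Fin.< v → φ u Fin.< φ v
    mono-≥t = AllPairs-drop-tabulate⁻ id (toℕ t) (proj₁ pieces)

    mono-<t : ∀ {u v} → toℕ v < toℕ t → u Fin.< v → φ u Fin.< φ v
    mono-<t = AllPairs-take-tabulate⁻ id (toℕ t) (proj₁ (proj₂ pieces))

    wrap : ∀ {u v} → toℕ u < toℕ t → toℕ t ≤ toℕ v → φ v Fin.< φ u
    wrap u<t t≤v = proj₂ (proj₂ pieces) (∈-drop-tabulate id (toℕ t) t≤v) (∈-take-tabulate id (toℕ t) u<t)

  -- The values increase along t, ..., h-1, 0, ..., t-1. Adding N to the run from t on moves it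
  -- behind the run 0, ..., t-1, which restores the order of the indices.
  lift : Fin h → ℕ
  lift u with toℕ u <? toℕ t
  ... | yes _ = toℕ (φ u)
  ... | no  _ = toℕ (φ u) + N

  lift-mono : ∀ {u v} → u Fin.< v → lift u < lift v
  lift-mono {u} {v} u<v with toℕ u <? toℕ t | toℕ v <? toℕ t
  ... | yes _   | yes v<t = mono-<t v<t u<v
  ... | yes _   | no  _   = <-≤-trans (φℕ<N u) (m≤n+m N _)
  ... | no  u≮t | yes v<t = contradiction (<-trans u<v v<t) u≮t
  ... | no  u≮t | no  _   = +-monoˡ-< N (mono-≥t (≮⇒≥ u≮t) u<v)

  -- Only the case u < t ≤ v uses the cyclic order: there φ v < φ u. The other cases follow from φ v
  -- < N.
  lift-window : ∀ u v → lift v < lift u + N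
  lift-window u v with toℕ u <? toℕ t | toℕ v <? toℕ t
  ... | yes _   | yes _   = <-≤-trans (φℕ<N v) (m≤n+m N _)
  ... | yes u<t | no  v≮t = +-monoˡ-< N (wrap u<t (≮⇒≥ v≮t))
  ... | no  _   | yes _   = <-≤-trans (φℕ<N v) (m≤n+m N _)
  ... | no  _   | no  _   = +-monoˡ-< N (<-≤-trans (φℕ<N v) (m≤n+m N _))

  -- Strictly increasing integers rise by at least one per step. The induction passes through the
  -- vertex with index u + d.
  lift-gap : ∀ d {u v} → toℕ u + d ≤ toℕ v → lift u + d ≤ lift v
  lift-gap zero {u} {v} u+0≤v with <-cmpᶠ u v
  ... | tri< u<v _ _  = subst (_≤ lift v) (sym (+-identityʳ _)) (<⇒≤ (lift-mono u<v))
  ... | tri≈ _ refl _ = ≤-reflexive (+-identityʳ _)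
  ... | tri> u≮v u≢v _ = contradiction (toℕ-injective (≤-antisym (subst (_≤ toℕ v) (+-identityʳ _) u+0≤v) (≮⇒≥ u≮v))) u≢v
  lift-gap (suc d) {u} {v} u+1+d≤v = begin
    lift u + suc d   ≡⟨ +-suc _ _ ⟩
    suc (lift u + d) ≤⟨ s≤s (lift-gap d (≤-reflexive (sym (toℕ-fromℕ< w<h)))) ⟩
    suc (lift w)     ≤⟨ lift-mono (subst (_< toℕ v) (sym (toℕ-fromℕ< w<h)) w<v) ⟩
    lift v           ∎
    where
    open ≤-Reasoning
    w<v : toℕ u + d < toℕ v
    w<v = subst (_≤ toℕ v) (+-suc _ _) u+1+d≤v
    w<h : toℕ u + d < h
    w<h = <-trans w<v (toℕ<n v)
    w : Fin h
    w = fromℕ< w<h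

  -- The coloring sees only the distance of the images. If the pair straddles t, the lifts differ by
  -- the complementary arc instead.
  lift-difference : ∀ {u v} → u Fin.< v →
    ∃[ e ] lift v ≡ lift u + e × (e ≡ ∣ toℕ (φ u) - toℕ (φ v) ∣ ⊎ e + ∣ toℕ (φ u) - toℕ (φ v) ∣ ≡ N)
  lift-difference {u} {v} u<v with toℕ u <? toℕ t | toℕ v <? toℕ t
  ... | yes _   | yes v<t = _ , sym (m+[n∸m]≡n x≤y) , inj₁ (sym (m≤n⇒∣m-n∣≡n∸m x≤y))
    where x≤y = <⇒≤ (mono-<t v<t u<v)
  ... | no  u≮t | yes v<t = contradiction (<-trans u<v v<t) u≮t
  ... | no  u≮t | no  _   = _ , shifted , inj₁ (sym (m≤n⇒∣m-n∣≡n∸m x≤y))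
    where
    x = toℕ (φ u)
    y = toℕ (φ v)
    x≤y = <⇒≤ (mono-≥t (≮⇒≥ u≮t) u<v)
    swap₂₃ : ∀ x d N → x + d + N ≡ x + N + d
    swap₂₃ = solve-∀
    shifted : y + N ≡ x + N + (y ∸ x)
    shifted = trans (cong (_+ N) (sym (m+[n∸m]≡n x≤y))) (swap₂₃ x (y ∸ x) N)
  ... | yes u<t | no  v≮t = N ∸ d , shifted , inj₂ (trans (cong (N ∸ d +_) dist≡d) (m∸n+n≡m d≤N))
    where
    x = toℕ (φ u)
    y = toℕ (φ v)
    d = x ∸ y
    y≤x = <⇒≤ (wrap u<t (≮⇒≥ v≮t))
    dist≡d : ∣ x - y ∣ ≡ d
    dist≡d = trans (∣-∣-comm x y) (m≤n⇒∣m-n∣≡n∸m y≤x)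
    d≤N : d ≤ N
    d≤N = ≤-trans (m∸n≤m x y) (<⇒≤ (φℕ<N u))
    shifted : y + N ≡ x + (N ∸ d)
    shifted = begin
      y + N              ≡⟨ cong (y +_) (m+[n∸m]≡n d≤N) ⟨
      y + (d + (N ∸ d))  ≡⟨ +-assoc y d _ ⟨
      y + d + (N ∸ d)    ≡⟨ cong (_+ (N ∸ d)) (m+[n∸m]≡n y≤x) ⟩
      x + (N ∸ d)        ∎
      where open ≡-Reasoning

-- `Far` treats the two arcs alike, so it can be tested on either one and hence on lifts.
far-complement : ∀ {d e} → e + d ≡ N → Far l N d → Far l N e
far-complement {l = l} {d} {e} refl (l≤d , d+l≤e+d) =
  +-cancelˡ-≤ d l e (subst (d + l ≤_) (+-comm e d) d+l≤e+d) , +-monoʳ-≤ e l≤d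

far⇒farLifts : ∀ x {e} → Far l N e → FarLifts l N x (x + e)
far⇒farLifts {l} {N} x {e} (l≤e , e+l≤N) =
  +-monoʳ-≤ x l≤e , subst (_≤ x + N) (sym (+-assoc x e l)) (+-monoʳ-≤ x e+l≤N)

farLifts⇒far : ∀ x {e} → FarLifts l N x (x + e) → Far l N e
farLifts⇒far {l} {N} x {e} (x+l≤x+e , x+e+l≤x+N) =
  +-cancelˡ-≤ x l e x+l≤x+e , +-cancelˡ-≤ x (e + l) N (subst (_≤ x + N) (+-assoc x e l) x+e+l≤x+N)

-- The lower bound

-- Describing an edge by its index sum avoids subtraction when the outermost, innermost and middle
-- chords are produced.
nestedPair : ∀ k i j → i ≤ k → i + j ≡ suc (k * 2) →
             ∃[ u ] ∃[ w ] toℕ u ≡ i × toℕ w ≡ j × NestedEdge (suc k * 2) u w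
nestedPair k i j i≤k i+j≡ = fromℕ< i<h , fromℕ< j<h , toℕ-fromℕ< i<h , toℕ-fromℕ< j<h ,
  subst₂ _<_ (sym (toℕ-fromℕ< i<h)) (sym (m*n/n≡m (suc k) 2)) (s≤s i≤k) ,
  trans (toℕ-fromℕ< j<h) (trans (sym (m+n∸m≡n i j)) (cong₂ _∸_ i+j≡ (sym (toℕ-fromℕ< i<h))))
  where
  i<h : i < suc k * 2
  i<h = s≤s (subst (i ≤_) i+j≡ (m≤m+n i j))
  j<h : j < suc k * 2
  j<h = s≤s (subst (j ≤_) i+j≡ (m≤n+m j i))

module _ {k m} (m≤N : m ≤ N) (φ : Fin (suc k * 2) → Fin m) (φ-cyc : CyclicallyIncreasing φ) where

  open Lift N m≤N φ φ-cyc

  private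
    middle : ∀ k → k + suc k ≡ suc (k * 2)
    middle = solve-∀

    total : ∀ r → r + (r + suc (r * 2)) ≡ suc (r * 2 * 2)
    total = solve-∀

    Distance : Fin (suc k * 2) → Fin (suc k * 2) → ℕ
    Distance u w = ∣ toℕ (φ u) - toℕ (φ w) ∣

    far-lift : ∀ {u w} → u Fin.< w → Far l N (Distance u w) → FarLifts l N (lift u) (lift w)
    far-lift {u = u} {w} u<w far with lift-difference u<w
    ... | e , lw≡ , inj₁ refl  rewrite lw≡ = far⇒farLifts (lift u) far
    ... | e , lw≡ , inj₂ e+d≡N rewrite lw≡ = far⇒farLifts (lift u) (far-complement e+d≡N far)

    far-unlift : ∀ {u w} → u Fin.< w → FarLifts l N (lift u) (lift w) → Far l N (Distance u w)
    far-unlift {u = u} {w} u<w farLifts with lift-difference u<w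
    ... | e , lw≡ , inj₁ refl  rewrite lw≡ = farLifts⇒far (lift u) farLifts
    ... | e , lw≡ , inj₂ e+d≡N rewrite lw≡ =
      far-complement (trans (+-comm _ e) e+d≡N) (farLifts⇒far (lift u) farLifts)

  -- The two extreme chords each cut off an arc of length at least l, and the remaining 2k gaps
  -- between consecutive points have length at least 1.
  far-nested⇒large : (∀ {u w} → NestedEdge (suc k * 2) u w → Far l N (Distance u w)) → (k + l) * 2 ≤ N
  far-nested⇒large {l = l} far
    with u₀ , w₀ , u₀≡ , w₀≡ , e₀ ← nestedPair k 0 (suc (k * 2)) z≤n refl
       | u₁ , w₁ , u₁≡ , w₁≡ , e₁ ← nestedPair k k (suc k) ≤-refl (middle k)
    = +-cancelˡ-≤ (lift u₀) _ _ (begin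
    lift u₀ + (k + l) * 2        ≡⟨ regroup (lift u₀) k l ⟩
    lift u₀ + k + l + k + l      ≤⟨ +-monoˡ-≤ l (+-monoˡ-≤ k (+-monoˡ-≤ l (lift-gap k u₀+k≤u₁))) ⟩
    lift u₁ + l + k + l          ≤⟨ +-monoˡ-≤ l (+-monoˡ-≤ k (proj₁ (far-lift u₁<w₁ (far e₁)))) ⟩
    lift w₁ + k + l              ≤⟨ +-monoˡ-≤ l (lift-gap k w₁+k≤w₀) ⟩
    lift w₀ + l                  ≤⟨ proj₂ (far-lift u₀<w₀ (far e₀)) ⟩
    lift u₀ + N                  ∎)
    where
    open ≤-Reasoning
    regroup : ∀ x k l → x + (k + l) * 2 ≡ x + k + l + k + l
    regroup = solve-∀
    outer : ∀ k → suc k + k ≡ suc (k * 2)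
    outer = solve-∀
    u₀+k≤u₁ : toℕ u₀ + k ≤ toℕ u₁
    u₀+k≤u₁ = ≤-reflexive (trans (cong (_+ k) u₀≡) (sym u₁≡))
    w₁+k≤w₀ : toℕ w₁ + k ≤ toℕ w₀
    w₁+k≤w₀ = ≤-reflexive (trans (cong (_+ k) w₁≡) (trans (outer k) (sym w₀≡)))
    u₁<w₁ : u₁ Fin.< w₁
    u₁<w₁ = subst₂ _<_ (sym u₁≡) (sym w₁≡) ≤-refl
    u₀<w₀ : u₀ Fin.< w₀
    u₀<w₀ = subst₂ _<_ (sym u₀≡) (sym w₀≡) z<s

  -- The middle one of the k + 1 chords has k endpoints on either side.
  middle-far : ∀ r → k ≡ r * 2 → ∃[ u ] ∃[ w ] NestedEdge (suc k * 2) u w × Far (suc k) N (Distance u w)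
  middle-far r refl
    with u₀ , w₀ , u₀≡ , w₀≡ , e₀ ← nestedPair k 0 (suc (k * 2)) z≤n refl
       | u₁ , w₁ , u₁≡ , w₁≡ , e₁ ← nestedPair k r (r + suc (r * 2)) (m≤m*n r 2) (total r)
    = u₁ , w₁ , e₁ , far-unlift u₁<w₁ (lift-gap (suc k) u₁+l≤w₁ , (begin
    -- The other arc runs from w₁ through w₀ and u₀ + N to u₁ + N. It has r steps on each side, and
    -- the strict window bound supplies the one step between w₀ and u₀ + N.
    lift w₁ + suc k          ≡⟨ regroup (lift w₁) r ⟩
    suc (lift w₁ + r) + r    ≤⟨ +-monoˡ-≤ r (s≤s (lift-gap r w₁+r≤w₀)) ⟩
    suc (lift w₀) + r        ≤⟨ +-monoˡ-≤ r (lift-window u₀ w₀) ⟩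
    lift u₀ + N + r          ≡⟨ swap₂₃ (lift u₀) N r ⟩
    lift u₀ + r + N          ≤⟨ +-monoˡ-≤ N (lift-gap r u₀+r≤u₁) ⟩
    lift u₁ + N              ∎))
    where
    open ≤-Reasoning
    regroup : ∀ x r → x + suc (r * 2) ≡ suc (x + r) + r
    regroup = solve-∀
    swap₂₃ : ∀ x y z → x + y + z ≡ x + z + y
    swap₂₃ = solve-∀
    outer : ∀ r → r + suc (r * 2) + r ≡ suc (r * 2 * 2)
    outer = solve-∀
    u₁+l≤w₁ : toℕ u₁ + suc k ≤ toℕ w₁
    u₁+l≤w₁ = ≤-reflexive (trans (cong (_+ suc k) u₁≡) (sym w₁≡))
    w₁+r≤w₀ : toℕ w₁ + r ≤ toℕ w₀
    w₁+r≤w₀ = ≤-reflexive (trans (cong (_+ r) w₁≡) (trans (outer r) (sym w₀≡)))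
    u₀+r≤u₁ : toℕ u₀ + r ≤ toℕ u₁
    u₀+r≤u₁ = ≤-reflexive (trans (cong (_+ r) u₀≡) (sym u₁≡))
    u₁<w₁ : u₁ Fin.< w₁
    u₁<w₁ = ≤-trans (subst (suc (toℕ u₁) ≤_) (sym (+-suc _ k)) (s≤s (m≤m+n _ k))) u₁+l≤w₁

-- The extremal coloring

module DistanceColoring (m l N : ℕ) {p q : Color} (p≢q : p ≢ q) where

  private
    pick : {P : Set} → Dec P → Color
    pick (yes _) = p
    pick (no  _) = q

    pick≡p : {P : Set} (P? : Dec P) → pick P? ≡ p → P
    pick≡p (yes x) _  = x
    pick≡p (no  _) eq = contradiction (sym eq) p≢q

    pick≡q : {P : Set} (P? : Dec P) → pick P? ≡ q → ¬ P
    pick≡q (yes _) eq = contradiction eq p≢q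
    pick≡q (no ¬x) _  = ¬x

  -- Far chords get color p and the others q; keeping p and q abstract serves both choices of the
  -- odd half. The circle has length N whatever m ≤ N is, so all smaller complete graphs are handled
  -- at once.
  distanceColoring : Coloring m
  distanceColoring = record
    { color = λ u v → pick (far? l N ∣ toℕ u - toℕ v ∣)
    ; symm  = λ u v → cong (λ d → pick (far? l N d)) (∣-∣-comm (toℕ u) (toℕ v))
    }

  avoids-far : m ≤ N → ∀ k → N < (k + l) * 2 →
               ¬ HasCyclicEmbedding (nestedMatching (suc k * 2)) distanceColoring p
  avoids-far m≤N k N<2[k+l] (φ , emb , φ-cyc) = <-irrefl refl (<-≤-trans N<2[k+l]
    (far-nested⇒large {k = k} m≤N φ φ-cyc far))
    where
    far : ∀ {u w} → NestedEdge (suc k * 2) u w → Far l N ∣ toℕ (φ u) - toℕ (φ w) ∣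
    far {u} {w} e = pick≡p (far? l N ∣ toℕ (φ u) - toℕ (φ w) ∣) (IsEmbedding.colored emb {u} {w} (inj₁ e))

  avoids-near : m ≤ N → ∀ r → l ≡ suc (r * 2) →
                ¬ HasCyclicEmbedding (nestedMatching (l * 2)) distanceColoring q
  avoids-near m≤N r refl (φ , emb , φ-cyc) = near (middle-far {k = r * 2} m≤N φ φ-cyc r refl)
    where
    near : ¬ (∃[ u ] ∃[ w ] NestedEdge (l * 2) u w × Far l N ∣ toℕ (φ u) - toℕ (φ w) ∣)
    near (u , w , e , far) =
      pick≡q (far? l N ∣ toℕ (φ u) - toℕ (φ w) ∣) (IsEmbedding.colored emb {u} {w} (inj₁ e)) far

-- Parity of the half-orders and conclusion

private
  size : ∀ k l → k * 2 + suc (suc (l * 2)) ≡ suc (k + l) * 2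
  size = solve-∀

  <-size : ∀ k l → suc ((k + l) * 2) < (k + suc l) * 2
  <-size k l = ≤-reflexive (step k l)
    where
    step : ∀ k l → suc (suc ((k + l) * 2)) ≡ (k + suc l) * 2
    step = solve-∀

  color₁≢color₂ : color₁ ≢ color₂
  color₁≢color₂ ()

¬arrows-odd₂ : ∀ k r → m < suc (k + r * 2) * 2 →
               ¬ CyclicArrows m (nestedMatching (suc k * 2)) (nestedMatching (suc (r * 2) * 2))
¬arrows-odd₂ {m} k r (s≤s m≤N) arr = [ avoids-far m≤N k (<-size k (r * 2)) , avoids-near m≤N r refl ]′
  (arr distanceColoring)
  -- The circle has length a + b - 3, and the threshold is the odd number b / 2.
  where open DistanceColoring m (suc (r * 2)) (suc ((k + r * 2) * 2)) color₁≢color₂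

¬arrows-odd₁ : ∀ r l → m < suc (l + r * 2) * 2 →
               ¬ CyclicArrows m (nestedMatching (suc (r * 2) * 2)) (nestedMatching (suc l * 2))
¬arrows-odd₁ {m} r l (s≤s m≤N) arr = [ avoids-near m≤N r refl , avoids-far m≤N l (<-size l (r * 2)) ]′
  (arr distanceColoring)
  -- Now a / 2 is the odd threshold, and the colors trade roles: far chords get `color₂`.
  where open DistanceColoring m (suc (r * 2)) (suc ((l + r * 2) * 2)) (color₁≢color₂ ∘ sym)

-- This makes the stack size k + 1 odd, so that a middle chord exists. The induction goes in steps
-- of two, each changing 2(k + 1) by 4.
¬4∣2[1+k]⇒even : ∀ k → ¬ (4 ∣ suc k * 2) → ∃[ r ] k ≡ r * 2
¬4∣2[1+k]⇒even zero          _  = 0 , refl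
¬4∣2[1+k]⇒even (suc zero)    ¬d = contradiction (divides 1 refl) ¬d
¬4∣2[1+k]⇒even (suc (suc k)) ¬d
  with r , refl ← ¬4∣2[1+k]⇒even k (λ { (divides c eq) → ¬d (divides (suc c) (cong (4 +_) eq)) }) = suc r , refl

theorem4p29 : (a b : ℕ) → 2 ≤ a → 2 ≤ b → 2 ∣ a → 2 ∣ b →
    (¬ (4 ∣ a)) ⊎ (¬ (4 ∣ b)) →
    IsRcyc (nestedMatching a) (nestedMatching b) (a + b ∸ 2)
theorem4p29 _ _ () _ (divides zero refl) _ _
theorem4p29 _ _ _ () (divides (suc _) refl) (divides zero refl) _
theorem4p29 _ _ _ _ (divides (suc k) refl) (divides (suc l) refl) 4∤ =
  -- By computation a + b - 2 is `k * 2 + suc (suc (l * 2))`, which `size` turns into twice the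
  -- number of chords.
  subst (IsRcyc (nestedMatching (suc k * 2)) (nestedMatching (suc l * 2))) (sym (size k l))
    (arrows k l , λ m arr → ≮⇒≥ λ m<n → lower 4∤ m<n arr)
  where
  lower : ∀ {m} → (¬ (4 ∣ suc k * 2)) ⊎ (¬ (4 ∣ suc l * 2)) → m < suc (k + l) * 2 →
          ¬ CyclicArrows m (nestedMatching (suc k * 2)) (nestedMatching (suc l * 2))
  lower {m} (inj₁ 4∤a) m<n with r , refl ← ¬4∣2[1+k]⇒even k 4∤a =
    ¬arrows-odd₁ r l (subst (λ x → m < suc x * 2) (+-comm (r * 2) l) m<n)
  lower (inj₂ 4∤b) m<n with r , refl ← ¬4∣2[1+k]⇒even l 4∤b = ¬arrows-odd₂ k r m<n
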